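{- Let $n$ be a positive integer and let $d$ be a divisor of $n$. Then for all real numbers $s, t$ with $1 \leq s \leq d$ and $1 \leq t \leq \frac{n}{d}$, $$u(d,s)\cdot u\!\left(\tfrac{n}{d},t\right) \geq u(n,st).$$
   Context: Divisors are positive divisors. For a positive integer $m$ and a real number $k$ with $1 \leq k \leq m$, let $d_1(m,k)$ denote the largest divisor of $m$ that is $\leq k$, and let $d_2(m,k)$ denote the smallest divisor of $m$ that is $\geq k$ (so $d_1(m,k) = d_2(m,k) = k$ if $k$ is a divisor of $m$). Writing $d_i = d_i(m,k)$ for $i=1,2$, define $$u(m,k) = \frac{m}{d_1 d_2}\,(d_1 + d_2 - k).$$ -}

module Defs where

open import Data.Nat as ℕ using (ℕ; zero; suc; z≤n; s≤s)
import Data.Nat.Properties as ℕₚ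
open import Data.Nat.Divisibility using (_∣_; ∣⇒≤; 1∣_; ∣-refl)
open import Data.Integer as ℤ using ()
open import Data.Rational as ℚ using (ℚ; 0ℚ; 1ℚ; ½)
import Data.Rational.Properties as ℚₚ
open import Data.Rational.Solver using (module +-*-Solver)
open import Data.Product using (∃; _×_; _,_; proj₁; proj₂)
open import Data.Sum using (_⊎_; inj₁; inj₂)
open import Relation.Nullary using (¬_; yes; no)
open import Relation.Nullary.Decidable using (¬¬-excluded-middle)
open import Relation.Binary.PropositionalEquality using (_≡_; refl; sym; trans; cong; subst)

infixl 6 _+_ _-_
infixl 7 _*_
infix  8 -_
infix  4 _≤_ _≥_

-- Real numbers as Cauchy sequences of rationals.  The sequences are not
-- quotiented; every notion below is invariant under the equivalence
-- "x ≤ y and y ≤ x".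

IsCauchy : (ℕ → ℚ) → Set
IsCauchy x = ∀ ε → 0ℚ ℚ.< ε →
  ∃ λ N → ∀ i j → N ℕ.≤ i → N ℕ.≤ j → ℚ.∣ x i ℚ.- x j ∣ ℚ.< ε

record ℝ : Set where
  constructor mkℝ
  field
    seq    : ℕ → ℚ
    cauchy : IsCauchy seq

open ℝ public

_≤_ : ℝ → ℝ → Set
x ≤ y = ∀ ε → 0ℚ ℚ.< ε →
  ∃ λ N → ∀ i → N ℕ.≤ i → seq x i ℚ.≤ seq y i ℚ.+ ε

_≥_ : ℝ → ℝ → Set
x ≥ y = y ≤ x

fromℚ : ℚ → ℝ
fromℚ q = mkℝ (λ _ → q) λ ε 0<ε →
  0 , λ _ _ _ _ → subst (ℚ._< ε) (sym (cong ℚ.∣_∣ (ℚₚ.+-inverseʳ q))) 0<ε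

fromℕ : ℕ → ℝ
fromℕ n = fromℚ (ℤ.+ n ℚ./ 1)

private
  +-difference : ∀ a b c d → (a ℚ.+ b) ℚ.- (c ℚ.+ d) ≡ (a ℚ.- c) ℚ.+ (b ℚ.- d)
  +-difference = solve 4 (λ a b c d → (a :+ b) :- (c :+ d) := (a :- c) :+ (b :- d)) refl
    where open +-*-Solver

  *-difference : ∀ a b c d → a ℚ.* b ℚ.- c ℚ.* d ≡ a ℚ.* (b ℚ.- d) ℚ.+ d ℚ.* (a ℚ.- c)
  *-difference = solve 4 (λ a b c d → a :* b :- c :* d := a :* (b :- d) :+ d :* (a :- c)) refl
    where open +-*-Solver

  split-at : ∀ a b → a ≡ b ℚ.+ (a ℚ.- b)
  split-at = solve 2 (λ a b → a := b :+ (a :- b)) refl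
    where open +-*-Solver

  half>0 : ∀ {ε} → 0ℚ ℚ.< ε → 0ℚ ℚ.< ½ ℚ.* ε
  half>0 {ε} 0<ε = ℚₚ.positive⁻¹ (½ ℚ.* ε) {{ℚₚ.pos*pos⇒pos ½ ε}}
    where instance _ = ℚ.positive 0<ε

  half+half : ∀ ε → ½ ℚ.* ε ℚ.+ ½ ℚ.* ε ≡ ε
  half+half ε = trans (sym (ℚₚ.*-distribʳ-+ ε ½ ½)) (ℚₚ.*-identityˡ ε)

  +-cauchy : ∀ x y → IsCauchy x → IsCauchy y → IsCauchy (λ i → x i ℚ.+ y i)
  +-cauchy x y cx cy ε 0<ε with cx (½ ℚ.* ε) (half>0 0<ε) | cy (½ ℚ.* ε) (half>0 0<ε)
  ... | N , hx | M , hy = N ℕ.⊔ M , λ i j le le′ → begin-strict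
      ℚ.∣ (x i ℚ.+ y i) ℚ.- (x j ℚ.+ y j) ∣
        ≡⟨ cong ℚ.∣_∣ (+-difference (x i) (y i) (x j) (y j)) ⟩
      ℚ.∣ (x i ℚ.- x j) ℚ.+ (y i ℚ.- y j) ∣
        ≤⟨ ℚₚ.∣p+q∣≤∣p∣+∣q∣ (x i ℚ.- x j) (y i ℚ.- y j) ⟩
      ℚ.∣ x i ℚ.- x j ∣ ℚ.+ ℚ.∣ y i ℚ.- y j ∣
        <⟨ ℚₚ.+-mono-< (hx i j (ℕₚ.m⊔n≤o⇒m≤o N M le) (ℕₚ.m⊔n≤o⇒m≤o N M le′))
                       (hy i j (ℕₚ.m⊔n≤o⇒n≤o N M le) (ℕₚ.m⊔n≤o⇒n≤o N M le′)) ⟩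
      ½ ℚ.* ε ℚ.+ ½ ℚ.* ε
        ≡⟨ half+half ε ⟩
      ε ∎
    where open ℚₚ.≤-Reasoning

  neg-cauchy : ∀ x → IsCauchy x → IsCauchy (λ i → ℚ.- x i)
  neg-cauchy x cx ε 0<ε with cx ε 0<ε
  ... | N , hx = N , λ i j le le′ → subst (ℚ._< ε)
      (trans (sym (ℚₚ.∣-p∣≡∣p∣ (x i ℚ.- x j))) (cong ℚ.∣_∣ (ℚₚ.neg-distrib-+ (x i) (ℚ.- x j))))
      (hx i j le le′)

  eventually-bounded : ∀ x → IsCauchy x →
    ∃ λ B → 0ℚ ℚ.< B × ∃ λ N → ∀ i → N ℕ.≤ i → ℚ.∣ x i ∣ ℚ.< B
  eventually-bounded x cx with cx 1ℚ (ℚₚ.positive⁻¹ 1ℚ)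
  ... | N , hx = ℚ.∣ x N ∣ ℚ.+ 1ℚ
      , ℚₚ.+-mono-≤-< (ℚₚ.0≤∣p∣ (x N)) (ℚₚ.positive⁻¹ 1ℚ)
      , N , λ i le → begin-strict
      ℚ.∣ x i ∣
        ≡⟨ cong ℚ.∣_∣ (split-at (x i) (x N)) ⟩
      ℚ.∣ x N ℚ.+ (x i ℚ.- x N) ∣
        ≤⟨ ℚₚ.∣p+q∣≤∣p∣+∣q∣ (x N) (x i ℚ.- x N) ⟩
      ℚ.∣ x N ∣ ℚ.+ ℚ.∣ x i ℚ.- x N ∣
        <⟨ ℚₚ.+-monoʳ-< ℚ.∣ x N ∣ (hx i N le ℕₚ.≤-refl) ⟩
      ℚ.∣ x N ∣ ℚ.+ 1ℚ ∎
    where open ℚₚ.≤-Reasoning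

  product-bound : ∀ a b A δ → 0ℚ ℚ.< δ → ℚ.∣ a ∣ ℚ.< A → ℚ.∣ b ∣ ℚ.< δ →
    ℚ.∣ a ℚ.* b ∣ ℚ.< A ℚ.* δ
  product-bound a b A δ 0<δ ha hb = begin-strict
      ℚ.∣ a ℚ.* b ∣         ≡⟨ ℚₚ.∣p*q∣≡∣p∣*∣q∣ a b ⟩
      ℚ.∣ a ∣ ℚ.* ℚ.∣ b ∣   ≤⟨ ℚₚ.*-monoˡ-≤-nonNeg ℚ.∣ a ∣ {{ℚ.nonNegative (ℚₚ.0≤∣p∣ a)}} (ℚₚ.<⇒≤ hb) ⟩
      ℚ.∣ a ∣ ℚ.* δ         <⟨ ℚₚ.*-monoˡ-<-pos δ {{ℚ.positive 0<δ}} ha ⟩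
      A ℚ.* δ ∎
    where open ℚₚ.≤-Reasoning

  product-difference-bound : ∀ a b c d A B δ → 0ℚ ℚ.< δ → ℚ.∣ a ∣ ℚ.< A → ℚ.∣ d ∣ ℚ.< B →
    ℚ.∣ b ℚ.- d ∣ ℚ.< δ → ℚ.∣ a ℚ.- c ∣ ℚ.< δ →
    ℚ.∣ a ℚ.* b ℚ.- c ℚ.* d ∣ ℚ.< A ℚ.* δ ℚ.+ B ℚ.* δ
  product-difference-bound a b c d A B δ 0<δ ha hd hb hc =
    subst (λ z → ℚ.∣ z ∣ ℚ.< A ℚ.* δ ℚ.+ B ℚ.* δ) (sym (*-difference a b c d))
      (ℚₚ.≤-<-trans (ℚₚ.∣p+q∣≤∣p∣+∣q∣ (a ℚ.* (b ℚ.- d)) (d ℚ.* (a ℚ.- c)))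
        (ℚₚ.+-mono-< {ℚ.∣ a ℚ.* (b ℚ.- d) ∣} {A ℚ.* δ} {ℚ.∣ d ℚ.* (a ℚ.- c) ∣} {B ℚ.* δ}
          (product-bound a (b ℚ.- d) A δ 0<δ ha hb)
          (product-bound d (a ℚ.- c) B δ 0<δ hd hc)))

  share : ∀ A B ε → 0ℚ ℚ.< A → 0ℚ ℚ.< B → 0ℚ ℚ.< ε →
    ∃ λ δ → 0ℚ ℚ.< δ × A ℚ.* δ ℚ.+ B ℚ.* δ ≡ ε
  share A B ε 0<A 0<B 0<ε = divide (A ℚ.+ B) refl (ℚₚ.+-mono-< 0<A 0<B)
    where
    divide : ∀ C → A ℚ.+ B ≡ C → 0ℚ ℚ.< C → ∃ λ δ → 0ℚ ℚ.< δ × A ℚ.* δ ℚ.+ B ℚ.* δ ≡ ε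
    divide C eq 0<C = ℚ.1/ C ℚ.* ε
      , ℚₚ.positive⁻¹ (ℚ.1/ C ℚ.* ε) {{ℚₚ.pos*pos⇒pos (ℚ.1/ C) {{ℚₚ.1/pos⇒pos C}} ε}}
      , trans (sym (ℚₚ.*-distribʳ-+ (ℚ.1/ C ℚ.* ε) A B))
       (trans (cong (ℚ._* (ℚ.1/ C ℚ.* ε)) eq)
       (trans (sym (ℚₚ.*-assoc C (ℚ.1/ C) ε))
       (trans (cong (ℚ._* ε) (ℚₚ.*-inverseʳ C)) (ℚₚ.*-identityˡ ε))))
      where
      instance
        C-pos : ℚ.Positive C
        C-pos = ℚ.positive 0<C
        C-nonZero : ℚ.NonZero C
        C-nonZero = ℚₚ.pos⇒nonZero C
        ε-pos : ℚ.Positive ε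
        ε-pos = ℚ.positive 0<ε

  EventuallyBoundedBy : ℚ → (ℕ → ℚ) → Set
  EventuallyBoundedBy B x = ∃ λ N → ∀ i → N ℕ.≤ i → ℚ.∣ x i ∣ ℚ.< B

  CloseWithin : ℚ → (ℕ → ℚ) → Set
  CloseWithin ε x = ∃ λ N → ∀ i j → N ℕ.≤ i → N ℕ.≤ j → ℚ.∣ x i ℚ.- x j ∣ ℚ.< ε

  *-close : ∀ x y A B δ → 0ℚ ℚ.< δ → EventuallyBoundedBy A x → EventuallyBoundedBy B y →
    CloseWithin δ x → CloseWithin δ y → CloseWithin (A ℚ.* δ ℚ.+ B ℚ.* δ) (λ i → x i ℚ.* y i)
  *-close x y A B δ 0<δ (N₁ , bx) (N₂ , by) (N₃ , hx) (N₄ , hy) =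
    (N₁ ℕ.⊔ N₂) ℕ.⊔ (N₃ ℕ.⊔ N₄) , λ i j le le′ →
      let l  = ℕₚ.m⊔n≤o⇒m≤o (N₁ ℕ.⊔ N₂) (N₃ ℕ.⊔ N₄) le
          r  = ℕₚ.m⊔n≤o⇒n≤o (N₁ ℕ.⊔ N₂) (N₃ ℕ.⊔ N₄) le
          l′ = ℕₚ.m⊔n≤o⇒m≤o (N₁ ℕ.⊔ N₂) (N₃ ℕ.⊔ N₄) le′
          r′ = ℕₚ.m⊔n≤o⇒n≤o (N₁ ℕ.⊔ N₂) (N₃ ℕ.⊔ N₄) le′
      in product-difference-bound (x i) (y i) (x j) (y j) A B δ 0<δ
           (bx i (ℕₚ.m⊔n≤o⇒m≤o N₁ N₂ l)) (by j (ℕₚ.m⊔n≤o⇒n≤o N₁ N₂ l′))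
           (hy i j (ℕₚ.m⊔n≤o⇒n≤o N₃ N₄ r) (ℕₚ.m⊔n≤o⇒n≤o N₃ N₄ r′))
           (hx i j (ℕₚ.m⊔n≤o⇒m≤o N₃ N₄ r) (ℕₚ.m⊔n≤o⇒m≤o N₃ N₄ r′))

  *-cauchy : ∀ x y → IsCauchy x → IsCauchy y → IsCauchy (λ i → x i ℚ.* y i)
  *-cauchy x y cx cy ε 0<ε =
    let (A , 0<A , bx)   = eventually-bounded x cx
        (B , 0<B , by)   = eventually-bounded y cy
        (δ , 0<δ , Cδ≡ε) = share A B ε 0<A 0<B 0<ε
    in subst (λ z → CloseWithin z (λ i → x i ℚ.* y i)) Cδ≡ε
         (*-close x y A B δ 0<δ bx by (cx δ 0<δ) (cy δ 0<δ))

_+_ : ℝ → ℝ → ℝ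
x + y = mkℝ (λ i → seq x i ℚ.+ seq y i) (+-cauchy (seq x) (seq y) (cauchy x) (cauchy y))

-_ : ℝ → ℝ
- x = mkℝ (λ i → ℚ.- seq x i) (neg-cauchy (seq x) (cauchy x))

_-_ : ℝ → ℝ → ℝ
x - y = x + (- y)

_*_ : ℝ → ℝ → ℝ
x * y = mkℝ (λ i → seq x i ℚ.* seq y i) (*-cauchy (seq x) (seq y) (cauchy x) (cauchy y))

_IsDivisorOf_ : ℕ → ℕ → Set
e IsDivisorOf m = ℕ.NonZero e × e ∣ m

-- d₁(m,k) and d₂(m,k) are given by their defining properties rather than as
-- functions of k, because _≤_ on ℝ is not decidable.  They are unique
-- (isD₁-unique, isD₂-unique) and, for 1 ≤ k ≤ m, cannot fail to exist
-- (¬¬-neighbours); classically they are therefore functions of m and k.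

IsD₁ : ℕ → ℝ → ℕ → Set
IsD₁ m k e = e IsDivisorOf m × fromℕ e ≤ k
           × (∀ e′ → e′ IsDivisorOf m → fromℕ e′ ≤ k → e′ ℕ.≤ e)

IsD₂ : ℕ → ℝ → ℕ → Set
IsD₂ m k e = e IsDivisorOf m × fromℕ e ≥ k
           × (∀ e′ → e′ IsDivisorOf m → fromℕ e′ ≥ k → e ℕ.≤ e′)

record Neighbours (m : ℕ) (k : ℝ) : Set where
  field
    d₁   : ℕ
    d₂   : ℕ
    isD₁ : IsD₁ m k d₁
    isD₂ : IsD₂ m k d₂

u : (m : ℕ) (k : ℝ) → Neighbours m k → ℝ
u m k N = fromℚ (ℤ.+ m ℚ./ (d₁ ℕ.* d₂)) * (fromℕ d₁ + fromℕ d₂ - k)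
  where
  open Neighbours N
  instance
    d₁d₂-nonZero : ℕ.NonZero (d₁ ℕ.* d₂)
    d₁d₂-nonZero = ℕₚ.m*n≢0 d₁ d₂ {{proj₁ (proj₁ isD₁)}} {{proj₁ (proj₁ isD₂)}}

isD₁-unique : ∀ {m k e e′} → IsD₁ m k e → IsD₁ m k e′ → e ≡ e′
isD₁-unique (p , q , max) (p′ , q′ , max′) = ℕₚ.≤-antisym (max′ _ p q) (max _ p′ q′)

isD₂-unique : ∀ {m k e e′} → IsD₂ m k e → IsD₂ m k e′ → e ≡ e′
isD₂-unique (p , q , min) (p′ , q′ , min′) = ℕₚ.≤-antisym (min _ p′ q′) (min′ _ p q)

private
  below : ∀ (P : ℕ → Set) {j} → ¬ P (suc j) → ∀ {e} → e ℕ.≤ suc j → P e → e ℕ.≤ j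
  below P ¬p le p = ℕₚ.≤-pred (ℕₚ.≤∧≢⇒< le λ { refl → ¬p p })

  ¬¬-largest : (P : ℕ → Set) (j : ℕ) → ¬ ¬ ((∃ λ e → P e × (∀ e′ → e′ ℕ.≤ j → P e′ → e′ ℕ.≤ e))
                                            ⊎ (∀ e → e ℕ.≤ j → ¬ P e))
  ¬¬-largest P zero k = ¬¬-excluded-middle {A = P 0} λ where
    (yes p) → k (inj₁ (0 , p , λ _ le _ → le))
    (no ¬p) → k (inj₂ λ { .zero z≤n → ¬p })
  ¬¬-largest P (suc j) k = ¬¬-excluded-middle {A = P (suc j)} λ where
    (yes p) → k (inj₁ (suc j , p , λ _ le _ → le))
    (no ¬p) → ¬¬-largest P j λ where
      (inj₁ (e , p , max)) → k (inj₁ (e , p , λ e′ le p′ → max e′ (below P ¬p le p′) p′))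
      (inj₂ none) → k (inj₂ λ e′ le p′ → none e′ (below P ¬p le p′) p′)

  ¬¬-smallest : (P : ℕ → Set) (j : ℕ) → ¬ ¬ ((∃ λ e → e ℕ.≤ j × P e × (∀ e′ → P e′ → e ℕ.≤ e′))
                                             ⊎ (∀ e → e ℕ.≤ j → ¬ P e))
  ¬¬-smallest P zero k = ¬¬-excluded-middle {A = P 0} λ where
    (yes p) → k (inj₁ (0 , z≤n , p , λ _ _ → z≤n))
    (no ¬p) → k (inj₂ λ { .zero z≤n → ¬p })
  ¬¬-smallest P (suc j) k = ¬¬-smallest P j λ where
    (inj₁ (e , le , p , min)) → k (inj₁ (e , ℕₚ.m≤n⇒m≤1+n le , p , min))
    (inj₂ none) → ¬¬-excluded-middle {A = P (suc j)} λ where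
      (yes p) → k (inj₁ (suc j , ℕₚ.≤-refl , p , λ e′ p′ → ℕₚ.≰⇒> λ le → none e′ le p′))
      (no ¬p) → k (inj₂ λ e′ le p′ → none e′ (below P ¬p le p′) p′)

¬¬-neighbours : ∀ m k → .{{_ : ℕ.NonZero m}} → fromℕ 1 ≤ k → k ≤ fromℕ m → ¬ ¬ Neighbours m k
¬¬-neighbours m@(suc _) k 1≤k k≤m fail =
  ¬¬-largest (λ e → e IsDivisorOf m × fromℕ e ≤ k) m λ where
    (inj₂ none) → none 1 (s≤s z≤n) ((_ , 1∣ m) , 1≤k)
    (inj₁ (e , (de , le) , max)) →
      ¬¬-smallest (λ e′ → e′ IsDivisorOf m × fromℕ e′ ≥ k) m λ where
        (inj₂ none) → none m ℕₚ.≤-refl ((_ , ∣-refl) , k≤m)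
        (inj₁ (f , _ , (df , ge) , min)) → fail record
          { d₁   = e
          ; d₂   = f
          ; isD₁ = de , le , λ e′ d′ le′ → max e′ (∣⇒≤ (proj₂ d′)) (d′ , le′)
          ; isD₂ = df , ge , λ e′ d′ ge′ → min e′ (d′ , ge′)
          }

{-# OPTIONS --safe #-}

-- As a function of k, u(m,k) is affine between neighbouring divisors of m and
-- equals m/k at a divisor k.  Let L be the affine function with
-- L(st) = u(n,st), attached to the neighbours e ≤ f of st.  No divisor x of n
-- lies strictly between e and f, so (x − e)(x − f) ≥ 0, i.e. L(x) ≤ n/x.
-- On the rectangle spanned by the neighbours of s and t, the difference
-- u(d,s) u(n/d,t) − L(st) is affine in s and in t, so it suffices to check
-- its sign at the corners (a,b); there it is n/(ab) − L(ab) ≥ 0 since ab ∣ n.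
module Submission where

open import Defs
open import Data.Nat using (ℕ; NonZero; _/_)
open import Data.Nat.Divisibility using (_∣_; *-pres-∣)
import Data.Nat as ℕ
import Data.Nat.Properties as ℕₚ
open import Data.Nat.DivMod using (m*[n/m]≡n)
open import Data.Integer using (+_)
import Data.Integer as ℤ
import Data.Integer.Properties as ℤₚ
open import Data.Rational as ℚ using (ℚ; 0ℚ; 1ℚ; ½; fromℚᵘ; toℚᵘ)
import Data.Rational.Properties as ℚₚ
open import Data.Rational.Solver using (module +-*-Solver)
open import Data.Rational.Unnormalised using (mkℚᵘ; *≡*; *≤*)
import Data.Rational.Unnormalised as ℚᵘ
import Data.Rational.Unnormalised.Properties as ℚᵘₚ
open import Data.Empty using (⊥-elim)
open import Data.Product using (∃; _×_; _,_; proj₁; proj₂)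
open import Data.Sum using (_⊎_; inj₁; inj₂)
open import Relation.Nullary using (¬_; yes; no)
open import Relation.Binary.PropositionalEquality using (_≡_; refl; sym; trans; cong; cong₂; subst; subst₂; module ≡-Reasoning)

open +-*-Solver using (solve; _:=_; _:+_; _:*_; _:-_; :-_)

-- Rational inequalities

0≤p+q : ∀ {p q} → 0ℚ ℚ.≤ p → 0ℚ ℚ.≤ q → 0ℚ ℚ.≤ p ℚ.+ q
0≤p+q = ℚₚ.+-mono-≤

0≤p*q : ∀ {p q} → 0ℚ ℚ.≤ p → 0ℚ ℚ.≤ q → 0ℚ ℚ.≤ p ℚ.* q
0≤p*q {p} {q} 0≤p 0≤q =
  ℚₚ.nonNegative⁻¹ (p ℚ.* q) {{ℚₚ.nonNeg*nonNeg⇒nonNeg p {{ℚ.nonNegative 0≤p}} q {{ℚ.nonNegative 0≤q}}}}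

p≤q⇒0≤q-p : ∀ {p q} → p ℚ.≤ q → 0ℚ ℚ.≤ q ℚ.- p
p≤q⇒0≤q-p {p} {q} p≤q = subst (ℚ._≤ q ℚ.- p) (ℚₚ.+-inverseʳ p) (ℚₚ.+-monoˡ-≤ (ℚ.- p) p≤q)

0≤q-p⇒p≤q : ∀ {p q} → 0ℚ ℚ.≤ q ℚ.- p → p ℚ.≤ q
0≤q-p⇒p≤q {p} {q} 0≤q-p = subst₂ ℚ._≤_ (ℚₚ.+-identityʳ p)
  (solve 2 (λ p q → p :+ (q :- p) := q) refl p q)
  (ℚₚ.+-monoʳ-≤ p 0≤q-p)

p≤p+ε : ∀ p {ε} → 0ℚ ℚ.< ε → p ℚ.≤ p ℚ.+ ε
p≤p+ε p 0<ε = subst (ℚ._≤ p ℚ.+ _) (ℚₚ.+-identityʳ p) (ℚₚ.+-monoʳ-≤ p (ℚₚ.<⇒≤ 0<ε))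

p≤∣p∣ : ∀ p → p ℚ.≤ ℚ.∣ p ∣
p≤∣p∣ p with ℚₚ.≤-total 0ℚ p
... | inj₁ 0≤p = ℚₚ.≤-reflexive (sym (ℚₚ.0≤p⇒∣p∣≡p 0≤p))
... | inj₂ p≤0 = ℚₚ.≤-trans p≤0 (ℚₚ.0≤∣p∣ p)

∣p-q∣<δ⇒p≤q+δ : ∀ p q {δ} → ℚ.∣ p ℚ.- q ∣ ℚ.< δ → p ℚ.≤ q ℚ.+ δ
∣p-q∣<δ⇒p≤q+δ p q {δ} close = subst (ℚ._≤ q ℚ.+ δ)
  (solve 2 (λ p q → q :+ (p :- q) := p) refl p q)
  (ℚₚ.+-monoʳ-≤ q (ℚₚ.≤-trans (p≤∣p∣ (p ℚ.- q)) (ℚₚ.<⇒≤ close)))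

½*ε>0 : ∀ {ε} → 0ℚ ℚ.< ε → 0ℚ ℚ.< ½ ℚ.* ε
½*ε>0 {ε} 0<ε = ℚₚ.positive⁻¹ (½ ℚ.* ε) {{ℚₚ.pos*pos⇒pos ½ ε {{ℚ.positive 0<ε}}}}

½*ε+½*ε≡ε : ∀ ε → ½ ℚ.* ε ℚ.+ ½ ℚ.* ε ≡ ε
½*ε+½*ε≡ε ε = trans (sym (ℚₚ.*-distribʳ-+ ε ½ ½)) (ℚₚ.*-identityˡ ε)

p≤q+ε⇒p≤q : ∀ {p q} → (∀ ε → 0ℚ ℚ.< ε → p ℚ.≤ q ℚ.+ ε) → p ℚ.≤ q
p≤q+ε⇒p≤q {p} {q} approx = ℚₚ.≮⇒≥ λ q<p →
  let (m , q<m , m<p) = ℚₚ.<-dense q<p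
      0<m-q = subst (ℚ._< m ℚ.- q) (ℚₚ.+-inverseʳ q) (ℚₚ.+-monoˡ-< (ℚ.- q) q<m)
      q+[m-q]≡m = solve 2 (λ q m → q :+ (m :- q) := m) refl q m
  in ℚₚ.<-irrefl refl (ℚₚ.<-≤-trans m<p (subst (p ℚ.≤_) q+[m-q]≡m (approx (m ℚ.- q) 0<m-q)))

divide : ∀ K ε → 0ℚ ℚ.< K → 0ℚ ℚ.< ε → ∃ λ δ → 0ℚ ℚ.< δ × K ℚ.* δ ≡ ε
divide K ε 0<K 0<ε = ℚ.1/ K ℚ.* ε
  , ℚₚ.positive⁻¹ (ℚ.1/ K ℚ.* ε) {{ℚₚ.pos*pos⇒pos (ℚ.1/ K) {{ℚₚ.1/pos⇒pos K}} ε}}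
  , trans (sym (ℚₚ.*-assoc K (ℚ.1/ K) ε))
      (trans (cong (ℚ._* ε) (ℚₚ.*-inverseʳ K)) (ℚₚ.*-identityˡ ε))
  where
  instance
    K-pos : ℚ.Positive K
    K-pos = ℚ.positive 0<K
    K-nonZero : ℚ.NonZero K
    K-nonZero = ℚₚ.pos⇒nonZero K
    ε-pos : ℚ.Positive ε
    ε-pos = ℚ.positive 0<ε

-- The gap between the two sides is `(x - e) * (x - f)`. Each case orients the factors so that both
-- are nonnegative, one of them by way of `e ≤ f`.
outside-interval : ∀ {e f x} → e ℚ.≤ f → x ℚ.≤ e ⊎ f ℚ.≤ x →
  x ℚ.* (e ℚ.+ f ℚ.- x) ℚ.≤ e ℚ.* f
outside-interval {e} {f} {x} e≤f (inj₁ x≤e) = 0≤q-p⇒p≤q (subst (0ℚ ℚ.≤_)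
  (solve 3 (λ e f x → (e :- x) :* (f :- x) := e :* f :- x :* (e :+ f :- x)) refl e f x)
  (0≤p*q (p≤q⇒0≤q-p x≤e) (p≤q⇒0≤q-p (ℚₚ.≤-trans x≤e e≤f))))
outside-interval {e} {f} {x} e≤f (inj₂ f≤x) = 0≤q-p⇒p≤q (subst (0ℚ ℚ.≤_)
  (solve 3 (λ e f x → (x :- e) :* (x :- f) := e :* f :- x :* (e :+ f :- x)) refl e f x)
  (0≤p*q (p≤q⇒0≤q-p (ℚₚ.≤-trans e≤f f≤x)) (p≤q⇒0≤q-p f≤x)))

-- Here `y` stands for `gef/x`, a point of a hyperbola, and is given by its product with `x` so that
-- no quotient appears. Cancelling `x > 0` reduces the claim to `outside`.
chord-below : ∀ g e f x y → 0ℚ ℚ.≤ g → 0ℚ ℚ.< x →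
  x ℚ.* (e ℚ.+ f ℚ.- x) ℚ.≤ e ℚ.* f → y ℚ.* x ≡ g ℚ.* (e ℚ.* f) →
  g ℚ.* (e ℚ.+ f ℚ.- x) ℚ.≤ y
chord-below g e f x y 0≤g 0<x outside yx≡gef = ℚₚ.*-cancelʳ-≤-pos x {{ℚ.positive 0<x}} (begin
  g ℚ.* (e ℚ.+ f ℚ.- x) ℚ.* x
    ≡⟨ solve 4 (λ g e f x → g :* (e :+ f :- x) :* x := g :* (x :* (e :+ f :- x))) refl g e f x ⟩
  g ℚ.* (x ℚ.* (e ℚ.+ f ℚ.- x))
    ≤⟨ ℚₚ.*-monoˡ-≤-nonNeg g {{ℚ.nonNegative 0≤g}} outside ⟩
  g ℚ.* (e ℚ.* f)
    ≡⟨ sym yx≡gef ⟩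
  y ℚ.* x ∎)
  where open ℚₚ.≤-Reasoning

-- The embedding of ℕ in ℚ

-- `fromℕ n` unfolds to `fromℚ (ι n)`, so facts about `ι` apply to the integers embedded in `ℝ`.
ι : ℕ → ℚ
ι n = + n ℚ./ 1

fromℚᵘ-homo-* : ∀ p q → fromℚᵘ (p ℚᵘ.* q) ≡ fromℚᵘ p ℚ.* fromℚᵘ q
fromℚᵘ-homo-* p q = ℚₚ.toℚᵘ-injective (begin-equality
  toℚᵘ (fromℚᵘ (p ℚᵘ.* q))
    ≃⟨ ℚₚ.toℚᵘ-fromℚᵘ (p ℚᵘ.* q) ⟩
  p ℚᵘ.* q
    ≃⟨ ℚᵘₚ.*-cong (ℚₚ.toℚᵘ-fromℚᵘ p) (ℚₚ.toℚᵘ-fromℚᵘ q) ⟨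
  toℚᵘ (fromℚᵘ p) ℚᵘ.* toℚᵘ (fromℚᵘ q)
    ≃⟨ ℚₚ.toℚᵘ-homo-* (fromℚᵘ p) (fromℚᵘ q) ⟨
  toℚᵘ (fromℚᵘ p ℚ.* fromℚᵘ q) ∎)
  where open ℚᵘₚ.≤-Reasoning

fromℚᵘ-mono-≤ : ∀ {p q} → p ℚᵘ.≤ q → fromℚᵘ p ℚ.≤ fromℚᵘ q
fromℚᵘ-mono-≤ {p} {q} p≤q = ℚₚ.toℚᵘ-cancel-≤ (begin
  toℚᵘ (fromℚᵘ p) ≃⟨ ℚₚ.toℚᵘ-fromℚᵘ p ⟩
  p               ≤⟨ p≤q ⟩
  q               ≃⟨ ℚₚ.toℚᵘ-fromℚᵘ q ⟨
  toℚᵘ (fromℚᵘ q) ∎)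
  where open ℚᵘₚ.≤-Reasoning

ι-* : ∀ m n → ι (m ℕ.* n) ≡ ι m ℚ.* ι n
ι-* m n = trans (cong (ℚ._/ 1) (ℤₚ.pos-* m n)) (fromℚᵘ-homo-* (mkℚᵘ (+ m) 0) (mkℚᵘ (+ n) 0))

ι-mono-≤ : ∀ {m n} → m ℕ.≤ n → ι m ℚ.≤ ι n
ι-mono-≤ {m} {n} m≤n = fromℚᵘ-mono-≤ {mkℚᵘ (+ m) 0} {mkℚᵘ (+ n) 0}
  (*≤* (ℤₚ.*-monoʳ-≤-nonNeg (+ 1) (ℤ.+≤+ m≤n)))

0<ι : ∀ n .{{_ : NonZero n}} → 0ℚ ℚ.< ι n
0<ι n = ℚₚ.positive⁻¹ (ι n) {{ℚₚ.normalize-pos n 1}}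

m/n*n≡m : ∀ m n .{{_ : NonZero n}} → (+ m ℚ./ n) ℚ.* ι n ≡ ι m
-- Exposing the successor makes `+ m ℚ./ n` equal by definition to `fromℚᵘ (mkℚᵘ (+ m) k)`.
m/n*n≡m m n@(ℕ.suc k) = trans (sym (fromℚᵘ-homo-* (mkℚᵘ (+ m) k) (mkℚᵘ (+ n) 0)))
  (ℚₚ.fromℚᵘ-cong {mkℚᵘ (+ m) k ℚᵘ.* mkℚᵘ (+ n) 0} {mkℚᵘ (+ m) 0} (*≡* eq))
  where
  eq : (+ m ℤ.* + n) ℤ.* + 1 ≡ + m ℤ.* (+ (n ℕ.* 1))
  eq = trans (ℤₚ.*-identityʳ (+ m ℤ.* + n)) (cong (λ z → + m ℤ.* + z) (sym (ℕₚ.*-identityʳ n)))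

m/[d*e]*[d*e]≡m : ∀ m d e .{{_ : NonZero (d ℕ.* e)}} →
  (+ m ℚ./ (d ℕ.* e)) ℚ.* (ι d ℚ.* ι e) ≡ ι m
m/[d*e]*[d*e]≡m m d e =
  trans (cong ((+ m ℚ./ (d ℕ.* e)) ℚ.*_) (sym (ι-* d e))) (m/n*n≡m m (d ℕ.* e))

-- The order on ℝ

fromℚ-≤-between : ∀ {p q} x → fromℚ p ≤ x → x ≤ fromℚ q → p ℚ.≤ q
fromℚ-≤-between {p} {q} x p≤x x≤q = p≤q+ε⇒p≤q λ ε 0<ε →
  let (N , hp) = p≤x (½ ℚ.* ε) (½*ε>0 0<ε)
      (M , hq) = x≤q (½ ℚ.* ε) (½*ε>0 0<ε)
      i = N ℕ.⊔ M
  in begin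
    p                                  ≤⟨ hp i (ℕₚ.m≤m⊔n N M) ⟩
    seq x i ℚ.+ ½ ℚ.* ε                ≤⟨ ℚₚ.+-monoˡ-≤ (½ ℚ.* ε) (hq i (ℕₚ.m≤n⊔m N M)) ⟩
    q ℚ.+ ½ ℚ.* ε ℚ.+ ½ ℚ.* ε          ≡⟨ ℚₚ.+-assoc q (½ ℚ.* ε) (½ ℚ.* ε) ⟩
    q ℚ.+ (½ ℚ.* ε ℚ.+ ½ ℚ.* ε)        ≡⟨ cong (q ℚ.+_) (½*ε+½*ε≡ε ε) ⟩
    q ℚ.+ ε                            ∎
  where open ℚₚ.≤-Reasoning

-- A constructive substitute for totality. From some `N` on, `x` varies by less than `ε/2`, and
-- comparing the single rational `seq x N` with `p + ε/2` is decidable. If it is larger, all later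
-- terms are at least `p`, contradicting the hypothesis.
≰-fromℚ⇒≥ : ∀ p x → ¬ (fromℚ p ≤ x) → x ≤ fromℚ p
≰-fromℚ⇒≥ p x p≰x ε 0<ε with cauchy x (½ ℚ.* ε) (½*ε>0 0<ε)
... | N , close with seq x N ℚ.≤? p ℚ.+ ½ ℚ.* ε
...   | yes xN≤ = N , λ i N≤i → begin
        seq x i                       ≤⟨ ∣p-q∣<δ⇒p≤q+δ (seq x i) (seq x N) (close i N N≤i ℕₚ.≤-refl) ⟩
        seq x N ℚ.+ ½ ℚ.* ε           ≤⟨ ℚₚ.+-monoˡ-≤ (½ ℚ.* ε) xN≤ ⟩
        p ℚ.+ ½ ℚ.* ε ℚ.+ ½ ℚ.* ε     ≡⟨ ℚₚ.+-assoc p (½ ℚ.* ε) (½ ℚ.* ε) ⟩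
        p ℚ.+ (½ ℚ.* ε ℚ.+ ½ ℚ.* ε)   ≡⟨ cong (p ℚ.+_) (½*ε+½*ε≡ε ε) ⟩
        p ℚ.+ ε                       ∎
  where open ℚₚ.≤-Reasoning
...   | no xN≰ = ⊥-elim (p≰x λ ε′ 0<ε′ → N , λ i N≤i →
        ℚₚ.≤-trans (p≤xi i N≤i) (p≤p+ε (seq x i) 0<ε′))
  where
  p≤xi : ∀ i → N ℕ.≤ i → p ℚ.≤ seq x i
  p≤xi i N≤i = 0≤q-p⇒p≤q (subst (0ℚ ℚ.≤_)
    (solve 4 (λ p h a b → (a :- (p :+ h)) :+ (b :+ h :- a) := b :- p) refl p (½ ℚ.* ε) (seq x N) (seq x i))
    (0≤p+q (p≤q⇒0≤q-p (ℚₚ.<⇒≤ (ℚₚ.≰⇒> xN≰)))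
           (p≤q⇒0≤q-p (∣p-q∣<δ⇒p≤q+δ (seq x N) (seq x i) (close N i ℕₚ.≤-refl N≤i)))))

-- Reals are not quotiented, so algebraic identities between them are used termwise, where the
-- rational ring solver proves them.
≤-resp-seq : ∀ {x x′ y y′} → (∀ i → seq x i ≡ seq x′ i) → (∀ i → seq y i ≡ seq y′ i) → x ≤ y → x′ ≤ y′
≤-resp-seq x≗x′ y≗y′ x≤y ε 0<ε =
  let (N , h) = x≤y ε 0<ε
  in N , λ i N≤i → subst₂ (λ a b → a ℚ.≤ b ℚ.+ ε) (x≗x′ i) (y≗y′ i) (h i N≤i)

x≤y⇒0≤y-x : ∀ x y → x ≤ y → fromℚ 0ℚ ≤ y - x
x≤y⇒0≤y-x x y x≤y ε 0<ε =
  let (N , h) = x≤y ε 0<ε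
  in N , λ i N≤i → subst (0ℚ ℚ.≤_)
       (solve 3 (λ a b ε → b :+ ε :- a := b :- a :+ ε) refl (seq x i) (seq y i) ε)
       (p≤q⇒0≤q-p (h i N≤i))

0≤y-x⇒x≤y : ∀ x y → fromℚ 0ℚ ≤ y - x → x ≤ y
0≤y-x⇒x≤y x y 0≤y-x ε 0<ε =
  let (N , h) = 0≤y-x ε 0<ε
  in N , λ i N≤i → 0≤q-p⇒p≤q (subst (0ℚ ℚ.≤_)
       (solve 3 (λ a b ε → b :- a :+ ε := b :+ ε :- a) refl (seq x i) (seq y i) ε)
       (h i N≤i))

fromℚ-mono-≤ : ∀ {p q} → p ℚ.≤ q → fromℚ p ≤ fromℚ q
fromℚ-mono-≤ {q = q} p≤q ε 0<ε = 0 , λ _ _ → ℚₚ.≤-trans p≤q (p≤p+ε q 0<ε)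

eventually-bounded : ∀ x → ∃ λ K → 0ℚ ℚ.< K × ∃ λ N → ∀ i → N ℕ.≤ i →
  seq x i ℚ.≤ K × ℚ.- seq x i ℚ.≤ K
eventually-bounded x with cauchy x 1ℚ (ℚₚ.positive⁻¹ 1ℚ)
... | N , close = ℚ.∣ seq x N ∣ ℚ.+ 1ℚ
  , ℚₚ.+-mono-≤-< (ℚₚ.0≤∣p∣ (seq x N)) (ℚₚ.positive⁻¹ 1ℚ)
  , N , λ i N≤i → ℚₚ.≤-trans (p≤∣p∣ (seq x i)) (bound i N≤i)
                , ℚₚ.≤-trans (p≤∣p∣ (ℚ.- seq x i))
                    (subst (ℚ._≤ ℚ.∣ seq x N ∣ ℚ.+ 1ℚ) (sym (ℚₚ.∣-p∣≡∣p∣ (seq x i))) (bound i N≤i))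
  where
  open ℚₚ.≤-Reasoning
  bound : ∀ i → N ℕ.≤ i → ℚ.∣ seq x i ∣ ℚ.≤ ℚ.∣ seq x N ∣ ℚ.+ 1ℚ
  bound i N≤i = begin
    ℚ.∣ seq x i ∣
      ≡⟨ cong ℚ.∣_∣ (solve 2 (λ a b → a := b :+ (a :- b)) refl (seq x i) (seq x N)) ⟩
    ℚ.∣ seq x N ℚ.+ (seq x i ℚ.- seq x N) ∣
      ≤⟨ ℚₚ.∣p+q∣≤∣p∣+∣q∣ (seq x N) (seq x i ℚ.- seq x N) ⟩
    ℚ.∣ seq x N ∣ ℚ.+ ℚ.∣ seq x i ℚ.- seq x N ∣
      ≤⟨ ℚₚ.+-monoʳ-≤ ℚ.∣ seq x N ∣ (ℚₚ.<⇒≤ (close i N N≤i ℕₚ.≤-refl)) ⟩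
    ℚ.∣ seq x N ∣ ℚ.+ 1ℚ ∎

-- Affine functions on an interval

-- Splitting on the sign of the slope b, rather than writing s as a convex
-- combination of p and q, also covers p = q.
affine-approx : ∀ a b s p q K δ η → 0ℚ ℚ.≤ δ → b ℚ.≤ K → ℚ.- b ℚ.≤ K →
  p ℚ.≤ s ℚ.+ δ → s ℚ.≤ q ℚ.+ δ →
  0ℚ ℚ.≤ a ℚ.+ b ℚ.* p ℚ.+ η → 0ℚ ℚ.≤ a ℚ.+ b ℚ.* q ℚ.+ η →
  0ℚ ℚ.≤ a ℚ.+ b ℚ.* s ℚ.+ (η ℚ.+ K ℚ.* δ)
affine-approx a b s p q K δ η 0≤δ b≤K -b≤K p≤s s≤q at-p at-q with ℚₚ.≤-total 0ℚ b
... | inj₁ 0≤b = subst (0ℚ ℚ.≤_)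
  (solve 7 (λ a b s p K δ η → (a :+ b :* p :+ η) :+ b :* (s :+ δ :- p) :+ (K :- b) :* δ
                              := a :+ b :* s :+ (η :+ K :* δ)) refl a b s p K δ η)
  (0≤p+q (0≤p+q at-p (0≤p*q 0≤b (p≤q⇒0≤q-p p≤s))) (0≤p*q (p≤q⇒0≤q-p b≤K) 0≤δ))
... | inj₂ b≤0 = subst (0ℚ ℚ.≤_)
  (solve 7 (λ a b s q K δ η → (a :+ b :* q :+ η) :+ (:- b) :* (q :+ δ :- s) :+ (K :- (:- b)) :* δ
                              := a :+ b :* s :+ (η :+ K :* δ)) refl a b s q K δ η)
  (0≤p+q (0≤p+q at-q (0≤p*q (ℚₚ.neg-antimono-≤ b≤0) (p≤q⇒0≤q-p s≤q))) (0≤p*q (p≤q⇒0≤q-p -b≤K) 0≤δ))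

-- Terms of `s` may leave the interval by a small `δ`, which the coefficient `b` magnifies by at
-- most its eventual bound `K`.
affine-nonNeg : ∀ a b s p q → fromℚ p ≤ s → s ≤ fromℚ q →
  fromℚ 0ℚ ≤ a + b * fromℚ p → fromℚ 0ℚ ≤ a + b * fromℚ q → fromℚ 0ℚ ≤ a + b * s
affine-nonNeg a b s p q p≤s s≤q at-p at-q ε 0<ε =
  let (K , 0<K , N₀ , bounded) = eventually-bounded b
      -- Half of `ε` pays for the overshoot `K * δ`, the other half for the slack at the endpoints.
      (δ , 0<δ , Kδ≡½ε)        = divide K (½ ℚ.* ε) 0<K (½*ε>0 0<ε)
      (N₁ , h₁) = p≤s δ 0<δ
      (N₂ , h₂) = s≤q δ 0<δ
      (N₃ , h₃) = at-p (½ ℚ.* ε) (½*ε>0 0<ε)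
      (N₄ , h₄) = at-q (½ ℚ.* ε) (½*ε>0 0<ε)
  in N₀ ℕ.⊔ (N₁ ℕ.⊔ (N₂ ℕ.⊔ (N₃ ℕ.⊔ N₄))) , λ i le →
    let le₁ = ℕₚ.m⊔n≤o⇒n≤o N₀ _ le
        le₂ = ℕₚ.m⊔n≤o⇒n≤o N₁ _ le₁
        le₃ = ℕₚ.m⊔n≤o⇒n≤o N₂ _ le₂
        (b≤K , -b≤K) = bounded i (ℕₚ.m⊔n≤o⇒m≤o N₀ _ le)
    in subst (λ z → 0ℚ ℚ.≤ seq a i ℚ.+ seq b i ℚ.* seq s i ℚ.+ z)
         (trans (cong (½ ℚ.* ε ℚ.+_) Kδ≡½ε) (½*ε+½*ε≡ε ε))
         (affine-approx (seq a i) (seq b i) (seq s i) p q K δ (½ ℚ.* ε) (ℚₚ.<⇒≤ 0<δ) b≤K -b≤K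
           (h₁ i (ℕₚ.m⊔n≤o⇒m≤o N₁ _ le₁)) (h₂ i (ℕₚ.m⊔n≤o⇒m≤o N₂ _ le₂))
           (h₃ i (ℕₚ.m⊔n≤o⇒m≤o N₃ _ le₃)) (h₄ i (ℕₚ.m⊔n≤o⇒n≤o N₃ _ le₃)))

-- Products of chords of hyperbolas

-- For `c = m/(pq)` this is the chord of the hyperbola `m/x` through its points at `p` and `q`, or
-- its tangent when `p = q`.
chord : ℚ → ℚ → ℚ → ℝ → ℝ
chord c p q x = fromℚ c * (fromℚ p + fromℚ q - x)

-- With `t` and `v` fixed, right side minus left side is `a + b * s`. Keeping `v` an arbitrary real
-- lets the lemma serve for either variable.
chord-product-on-interval : ∀ c p q g e f s t v → fromℚ p ≤ s → s ≤ fromℚ q →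
  chord g e f (fromℚ p * t) ≤ chord c p q (fromℚ p) * v →
  chord g e f (fromℚ q * t) ≤ chord c p q (fromℚ q) * v →
  chord g e f (s * t) ≤ chord c p q s * v
chord-product-on-interval c p q g e f s t v p≤s s≤q at-p at-q =
  0≤y-x⇒x≤y (chord g e f (s * t)) (chord c p q s * v)
    (≤-resp-seq {fromℚ 0ℚ} {fromℚ 0ℚ} {a + b * s} {difference s} (λ _ → refl) (λ i → sym (expand s i))
      (affine-nonNeg a b s p q p≤s s≤q (endpoint (fromℚ p) at-p) (endpoint (fromℚ q) at-q)))
  where
  a b : ℝ
  a = fromℚ (c ℚ.* (p ℚ.+ q)) * v - fromℚ (g ℚ.* (e ℚ.+ f))
  b = fromℚ g * t - fromℚ c * v

  difference : ℝ → ℝ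
  difference x = chord c p q x * v - chord g e f (x * t)

  expand : ∀ x i → seq (difference x) i ≡ seq (a + b * x) i
  expand x i = solve 9 (λ c p q g e f x t v →
    c :* (p :+ q :- x) :* v :- g :* (e :+ f :- x :* t)
    := (c :* (p :+ q) :* v :- g :* (e :+ f)) :+ (g :* t :- c :* v) :* x) refl
    c p q g e f (seq x i) (seq t i) (seq v i)

  endpoint : ∀ x → chord g e f (x * t) ≤ chord c p q x * v → fromℚ 0ℚ ≤ a + b * x
  endpoint x le = ≤-resp-seq {fromℚ 0ℚ} {fromℚ 0ℚ} {difference x} {a + b * x} (λ _ → refl) (expand x)
    (x≤y⇒0≤y-x (chord g e f (x * t)) (chord c p q x * v) le)

chord-product-on-rectangle : ∀ c p q c′ p′ q′ g e f s t →
  fromℚ p ≤ s → s ≤ fromℚ q → fromℚ p′ ≤ t → t ≤ fromℚ q′ →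
  (∀ x y → x ≡ p ⊎ x ≡ q → y ≡ p′ ⊎ y ≡ q′ →
    g ℚ.* (e ℚ.+ f ℚ.- x ℚ.* y) ℚ.≤ c ℚ.* (p ℚ.+ q ℚ.- x) ℚ.* (c′ ℚ.* (p′ ℚ.+ q′ ℚ.- y))) →
  chord g e f (s * t) ≤ chord c p q s * chord c′ p′ q′ t
chord-product-on-rectangle c p q c′ p′ q′ g e f s t p≤s s≤q p′≤t t≤q′ corner =
  -- The interval lemma moves the first factor: `t` moves first with `s` fixed, then `side` moves
  -- `s` with `t` at an endpoint.
  swap t s (chord c′ p′ q′ t) (chord c p q s)
    (chord-product-on-interval c′ p′ q′ g e f t s (chord c p q s) p′≤t t≤q′
      (side p′ (inj₁ refl)) (side q′ (inj₂ refl)))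
  where
  swap : ∀ x y v w → chord g e f (x * y) ≤ v * w → chord g e f (y * x) ≤ w * v
  swap x y v w = ≤-resp-seq {chord g e f (x * y)} {chord g e f (y * x)} {v * w} {w * v}
    (λ i → cong (λ z → g ℚ.* (e ℚ.+ f ℚ.- z)) (ℚₚ.*-comm (seq x i) (seq y i)))
    (λ i → ℚₚ.*-comm (seq v i) (seq w i))

  side : ∀ y → y ≡ p′ ⊎ y ≡ q′ →
    chord g e f (fromℚ y * s) ≤ chord c′ p′ q′ (fromℚ y) * chord c p q s
  side y y∈ = swap s (fromℚ y) (chord c p q s) (chord c′ p′ q′ (fromℚ y))
    (chord-product-on-interval c p q g e f s (fromℚ y) (chord c′ p′ q′ (fromℚ y)) p≤s s≤q
      -- At a corner both sides are constant sequences, so the rational inequality lifts.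
      (fromℚ-mono-≤ (corner p y (inj₁ refl) y∈))
      (fromℚ-mono-≤ (corner q y (inj₂ refl) y∈)))

-- Neighbouring divisors

-- The case split compares `e` with `d₁` in `ℕ`, which is decidable, unlike comparison with `k`. If
-- `e` exceeds `d₁`, maximality refutes `e ≤ k`; hence `k ≤ e`, and minimality of `d₂` applies.
neighbours-adjacent : ∀ {m k} (N : Neighbours m k) → let open Neighbours N in
  ∀ e → e IsDivisorOf m → e ℕ.≤ d₁ ⊎ d₂ ℕ.≤ e
neighbours-adjacent {m} {k} N e e∣m with e ℕ.≤? Neighbours.d₁ N
... | yes e≤d₁ = inj₁ e≤d₁
... | no  e≰d₁ = inj₂ (proj₂ (proj₂ isD₂) e e∣m
        (≰-fromℚ⇒≥ (ι e) k λ e≤k → e≰d₁ (proj₂ (proj₂ isD₁) e e∣m e≤k)))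
  where open Neighbours N

neighbours-outside : ∀ {m k} (N : Neighbours m k) → let open Neighbours N in
  ∀ e → e IsDivisorOf m → ι e ℚ.* (ι d₁ ℚ.+ ι d₂ ℚ.- ι e) ℚ.≤ ι d₁ ℚ.* ι d₂
neighbours-outside {m} {k} N e e∣m =
  outside-interval (fromℚ-≤-between k (proj₁ (proj₂ isD₁)) (proj₁ (proj₂ isD₂)))
    (embed (neighbours-adjacent N e e∣m))
  where
  open Neighbours N
  embed : e ℕ.≤ d₁ ⊎ d₂ ℕ.≤ e → ι e ℚ.≤ ι d₁ ⊎ ι d₂ ℚ.≤ ι e
  embed (inj₁ le) = inj₁ (ι-mono-≤ le)
  embed (inj₂ le) = inj₂ (ι-mono-≤ le)

-- The coefficient occurring in `u`, so that `u m k N` unfolds to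
-- `chord (slope m k N) (ι d₁) (ι d₂) k`. As a function of `k` this has slope minus the coefficient.
slope : ∀ m k → Neighbours m k → ℚ
slope m k N = (+ m ℚ./ (d₁ ℕ.* d₂)) {{ℕₚ.m*n≢0 d₁ d₂ {{proj₁ (proj₁ isD₁)}} {{proj₁ (proj₁ isD₂)}}}}
  where open Neighbours N

slope*d₁*d₂ : ∀ m k (N : Neighbours m k) → let open Neighbours N in
  slope m k N ℚ.* (ι d₁ ℚ.* ι d₂) ≡ ι m
slope*d₁*d₂ m k N =
  m/[d*e]*[d*e]≡m m d₁ d₂ {{ℕₚ.m*n≢0 d₁ d₂ {{proj₁ (proj₁ isD₁)}} {{proj₁ (proj₁ isD₂)}}}}
  where open Neighbours N

0≤slope : ∀ m k (N : Neighbours m k) → 0ℚ ℚ.≤ slope m k N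
0≤slope m k N = ℚₚ.nonNegative⁻¹ (slope m k N) {{ℚₚ.normalize-nonNeg m (d₁ ℕ.* d₂)}}
  where
  open Neighbours N
  instance
    d₁d₂≢0 : NonZero (d₁ ℕ.* d₂)
    d₁d₂≢0 = ℕₚ.m*n≢0 d₁ d₂ {{proj₁ (proj₁ isD₁)}} {{proj₁ (proj₁ isD₂)}}

-- At one neighbour the bracket reduces to the other, so the chord takes the value `m/x`. The
-- divisor `e` is returned because the corner argument needs its divisibility.
neighbour-value : ∀ m k (N : Neighbours m k) → let open Neighbours N in
  ∀ x → x ≡ ι d₁ ⊎ x ≡ ι d₂ →
  ∃ λ e → e IsDivisorOf m × x ≡ ι e × slope m k N ℚ.* (ι d₁ ℚ.+ ι d₂ ℚ.- x) ℚ.* x ≡ ι m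
neighbour-value m k N _ (inj₁ refl) = d₁ , proj₁ isD₁ , refl , trans
  (solve 3 (λ c p q → c :* (p :+ q :- p) :* p := c :* (p :* q)) refl (slope m k N) (ι d₁) (ι d₂))
  (slope*d₁*d₂ m k N)
  where open Neighbours N
neighbour-value m k N _ (inj₂ refl) = d₂ , proj₁ isD₂ , refl , trans
  (solve 3 (λ c p q → c :* (p :+ q :- q) :* q := c :* (p :* q)) refl (slope m k N) (ι d₁) (ι d₂))
  (slope*d₁*d₂ m k N)
  where open Neighbours N

proposition1p4 : (n d : ℕ) .{{_ : NonZero n}} .{{_ : NonZero d}} → d ∣ n →
    (s t : ℝ) →
    fromℕ 1 ≤ s → s ≤ fromℕ d →
    fromℕ 1 ≤ t → t ≤ fromℕ (n / d) →
    (S : Neighbours d s) (T : Neighbours (n / d) t) (ST : Neighbours n (s * t)) →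
    u d s S * u (n / d) t T ≥ u n (s * t) ST
proposition1p4 n d d∣n s t _ _ _ _ S T ST =
  chord-product-on-rectangle (slope d s S) (ι S.d₁) (ι S.d₂) (slope (n / d) t T) (ι T.d₁) (ι T.d₂)
    (slope n (s * t) ST) (ι ST.d₁) (ι ST.d₂) s t
    (proj₁ (proj₂ S.isD₁)) (proj₁ (proj₂ S.isD₂)) (proj₁ (proj₂ T.isD₁)) (proj₁ (proj₂ T.isD₂)) corner
  where
  module S = Neighbours S
  module T = Neighbours T
  module ST = Neighbours ST

  corner : ∀ x y → x ≡ ι S.d₁ ⊎ x ≡ ι S.d₂ → y ≡ ι T.d₁ ⊎ y ≡ ι T.d₂ →
    slope n (s * t) ST ℚ.* (ι ST.d₁ ℚ.+ ι ST.d₂ ℚ.- x ℚ.* y) ℚ.≤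
    slope d s S ℚ.* (ι S.d₁ ℚ.+ ι S.d₂ ℚ.- x) ℚ.* (slope (n / d) t T ℚ.* (ι T.d₁ ℚ.+ ι T.d₂ ℚ.- y))
  corner x y x∈ y∈ with neighbour-value d s S x x∈ | neighbour-value (n / d) t T y y∈
  ... | a , (a≢0 , a∣d) , refl , eqa | b , (b≢0 , b∣n/d) , refl , eqb =
    -- The corner product is rewritten as the embedded integer `a * b`, a divisor of `n`, which
    -- therefore avoids the open interval between the neighbours of `s * t`.
    subst (λ z → slope n (s * t) ST ℚ.* (ι ST.d₁ ℚ.+ ι ST.d₂ ℚ.- z) ℚ.≤ v ℚ.* w) (ι-* a b)
      (chord-below (slope n (s * t) ST) (ι ST.d₁) (ι ST.d₂) (ι (a ℕ.* b)) (v ℚ.* w)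
        (0≤slope n (s * t) ST) (0<ι (a ℕ.* b)) (neighbours-outside ST (a ℕ.* b) (ab≢0 , ab∣n)) product)
    where
    v w : ℚ
    v = slope d s S ℚ.* (ι S.d₁ ℚ.+ ι S.d₂ ℚ.- ι a)
    w = slope (n / d) t T ℚ.* (ι T.d₁ ℚ.+ ι T.d₂ ℚ.- ι b)

    instance
      ab≢0 : NonZero (a ℕ.* b)
      ab≢0 = ℕₚ.m*n≢0 a b {{a≢0}} {{b≢0}}

    ab∣n : a ℕ.* b ∣ n
    ab∣n = subst (a ℕ.* b ∣_) (m*[n/m]≡n d∣n) (*-pres-∣ a∣d b∣n/d)

    open ≡-Reasoning
    -- Since `v * a = d` and `w * b = n/d`, the corner value `v * w` is `n/(ab)`, on the hyperbola
    -- whose chord belongs to `ST`.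
    product : v ℚ.* w ℚ.* ι (a ℕ.* b) ≡ slope n (s * t) ST ℚ.* (ι ST.d₁ ℚ.* ι ST.d₂)
    product = begin
      v ℚ.* w ℚ.* ι (a ℕ.* b)
        ≡⟨ cong (v ℚ.* w ℚ.*_) (ι-* a b) ⟩
      v ℚ.* w ℚ.* (ι a ℚ.* ι b)
        ≡⟨ solve 4 (λ v w a b → v :* w :* (a :* b) := v :* a :* (w :* b)) refl v w (ι a) (ι b) ⟩
      v ℚ.* ι a ℚ.* (w ℚ.* ι b)
        ≡⟨ cong₂ ℚ._*_ eqa eqb ⟩
      ι d ℚ.* ι (n / d)
        ≡⟨ sym (ι-* d (n / d)) ⟩
      ι (d ℕ.* (n / d))
        ≡⟨ cong ι (m*[n/m]≡n d∣n) ⟩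
      ι n
        ≡⟨ sym (slope*d₁*d₂ n (s * t) ST) ⟩
      slope n (s * t) ST ℚ.* (ι ST.d₁ ℚ.* ι ST.d₂) ∎
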